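{- Let $(X,\mathcal{A})$ be a $(v,k,\lambda)$-BIBD. Then $(X,\mathcal{A})$ has a perfect nesting if and only if $(X,\mathcal{A})$ is a Banff design having an exact colouring.
   Context: A $(v,k,\lambda)$-BIBD is a pair $(X,\mathcal{A})$ where $X$ is a set of $v$ points and $\mathcal{A}$ is a multiset of $k$-subsets of $X$ (blocks) such that every pair of distinct points lies in exactly $\lambda$ blocks. A perfect nesting of $(X,\mathcal{A})$ is a map $\phi:\mathcal{A}\to X$ with $\phi(A)\notin A$ for all $A$ such that $(X,\{A\cup\{\phi(A)\}:A\in\mathcal{A}\})$ is a $(v,k+1,\lambda+1)$-BIBD. The Levi graph $\mathcal{L}(X,\mathcal{A})$ is the bipartite graph with vertex set $X\cup\mathcal{A}$ (each block a separate vertex) and an edge $\{x,A\}$ whenever $x\in A$. A harmonious colouring of a graph is a map $c$ from vertices to colours such that adjacent vertices receive different colours and no two distinct edges receive the same unordered pair of colours; the harmonious chromatic number $h$ is the minimum number of colours in a harmonious colouring. $(X,\mathcal{A})$ is a Banff design if $h(\mathcal{L}(X,\mathcal{A}))=v$; a Banff design has an exact colouring if there is a harmonious colouring of $\mathcal{L}(X,\mathcal{A})$ with $v$ colours in which every pair of distinct colours occurs on exactly one edge. -}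

module Defs where

open import Data.Empty using (⊥)
open import Data.Fin using (Fin)
open import Data.Fin.Subset using (Subset; _∈_; _∉_; _∪_; ⁅_⁆; ∣_∣)
open import Data.Fin.Subset.Properties using (_∈?_)
open import Data.Nat using (ℕ; suc; _≤_)
open import Data.Product using (_×_; _,_; Σ-syntax; ∃!; uncurry; swap; map)
open import Data.Sum using (_⊎_; inj₁; inj₂)
open import Data.Vec using (count; tabulate)
open import Relation.Binary.Definitions using (Symmetric; Irreflexive)
open import Relation.Binary.PropositionalEquality using (_≡_; _≢_; refl)
open import Relation.Nullary.Decidable using (_×-dec_)

-- The point set is Fin v.  The multiset of blocks is an indexed family, so
-- equal blocks with different indices are different members of it.
record Design (v : ℕ) : Set where
  field
    b     : ℕ
    block : Fin b → Subset v

open Design public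

pairCount : ∀ {v} → Design v → Fin v → Fin v → ℕ
pairCount D x y =
  count (λ A → (x ∈? A) ×-dec (y ∈? A)) (tabulate (block D))

record IsBIBD (v k ƛ : ℕ) (D : Design v) : Set where
  field
    blockSize : ∀ i → ∣ block D i ∣ ≡ k
    balanced  : ∀ x y → x ≢ y → pairCount D x y ≡ ƛ

augment : ∀ {v} (D : Design v) → (Fin (b D) → Fin v) → Design v
augment D φ = record { b = b D ; block = λ i → block D i ∪ ⁅ φ i ⁆ }

record IsPerfectNesting (v k ƛ : ℕ) (D : Design v)
                        (φ : Fin (b D) → Fin v) : Set where
  field
    outside : ∀ i → φ i ∉ block D i
    nested  : IsBIBD v (suc k) (suc ƛ) (augment D φ)

HasPerfectNesting : (v k ƛ : ℕ) → Design v → Set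
HasPerfectNesting v k ƛ D =
  Σ[ φ ∈ (Fin (b D) → Fin v) ] IsPerfectNesting v k ƛ D φ

record Graph : Set₁ where
  field
    Vertex : Set
    Adj    : Vertex → Vertex → Set
    sym    : Symmetric Adj
    irrefl : Irreflexive _≡_ Adj

open Graph public

module _ {v : ℕ} (D : Design v) where

  LeviAdj : Fin v ⊎ Fin (b D) → Fin v ⊎ Fin (b D) → Set
  LeviAdj (inj₁ x) (inj₂ i) = x ∈ block D i
  LeviAdj (inj₂ i) (inj₁ x) = x ∈ block D i
  LeviAdj (inj₁ _) (inj₁ _) = ⊥
  LeviAdj (inj₂ _) (inj₂ _) = ⊥

  leviSym : Symmetric LeviAdj
  leviSym {inj₁ _} {inj₂ _} x∈A = x∈A
  leviSym {inj₂ _} {inj₁ _} x∈A = x∈A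

  leviIrrefl : Irreflexive _≡_ LeviAdj
  leviIrrefl {inj₁ _} refl ()
  leviIrrefl {inj₂ _} refl ()

  Levi : Graph
  Levi = record
    { Vertex = Fin v ⊎ Fin (b D)
    ; Adj    = LeviAdj
    ; sym    = leviSym
    ; irrefl = leviIrrefl
    }

infix 4 _≐_

-- Unordered pairs are ordered pairs considered up to _≐_.
_≐_ : {A : Set} → A × A → A × A → Set
p ≐ q = p ≡ q ⊎ p ≡ swap q

-- An edge is an adjacent pair of vertices, up to _≐_.
Edge : (G : Graph) → Vertex G × Vertex G → Set
Edge G = uncurry (Adj G)

record IsHarmonious (G : Graph) {C : Set} (c : Vertex G → C) : Set where
  field
    proper     : ∀ {u w} → Adj G u w → c u ≢ c w
    harmonious : ∀ {e f} → Edge G e → Edge G f →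
                 map c c e ≐ map c c f → e ≐ f

HarmoniouslyColourable : Graph → ℕ → Set
HarmoniouslyColourable G n = Σ[ c ∈ (Vertex G → Fin n) ] IsHarmonious G c

record IsHarmoniousChromaticNumber (G : Graph) (h : ℕ) : Set where
  field
    colourable : HarmoniouslyColourable G h
    minimal    : ∀ n → HarmoniouslyColourable G n → h ≤ n

IsBanff : (v : ℕ) → Design v → Set
IsBanff v D = IsHarmoniousChromaticNumber (Levi D) v

IsExact : (G : Graph) {C : Set} → (Vertex G → C) → Set
IsExact G c = ∀ p q → p ≢ q →
  ∃! _≐_ (λ e → Edge G e × map c c e ≐ (p , q))

HasExactColouring : (v : ℕ) → Design v → Set
HasExactColouring v D =
  Σ[ c ∈ (Vertex (Levi D) → Fin v) ] (IsHarmonious (Levi D) c × IsExact (Levi D) c)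

{-# OPTIONS --safe #-}

-- Take every point as its own colour and φ(A) as the colour of the block A.
-- For distinct points x and y, the blocks A ∪ {φ(A)} containing both number λ,
-- plus the edges of the Levi graph coloured {x , y}.  Hence φ is a perfect
-- nesting exactly when this colouring is harmonious and exact.  An exact
-- colouring with v colours forces v ≤ n for any harmonious colouring with n
-- colours, because distinct pairs of colours come from distinct edges.
--
-- Conversely, an exact colouring yields a nesting once the points have distinct
-- colours.  This is automatic for λ ≥ 1.  For λ = 0 each block has at most one
-- point, and an exact colouring with two points p and q of the same colour a
-- leaves some colour z without points.  Giving p the colour z and exchanging
-- a and z suitably on the blocks keeps the colouring exact.
module Submission where

open import Defs hiding (sym)
open import Data.Bool using (Bool; true; false; if_then_else_)
  renaming (_≟_ to _≟ᵇ_)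
open import Data.Fin using (Fin; zero; suc; toℕ; fromℕ<; punchIn; punchOut; combine; remQuot)
open import Data.Fin.Properties
  using (_≟_; any?; toℕ-injective; toℕ-fromℕ<; toℕ<n; injective⇒≤; punchOut-injective;
         punchInᵢ≢i; punchIn-injective; combine-injective; combine-remQuot)
  renaming (suc-injective to Fin-suc-injective)
open import Data.Fin.Permutation.Components using (transpose; transpose-inverse)
open import Data.Fin.Subset using (Subset; _∈_; _∉_; _∪_; ⁅_⁆; ∣_∣; inside; outside)
open import Data.Fin.Subset.Properties
  using (_∈?_; x∈p∪q⁻; x∈p∪q⁺; x∈⁅x⁆; x∈⁅y⁆⇒x≡y; ∪-identityʳ)
open import Data.Nat using (ℕ; zero; suc; _+_; _*_; _≤_; _<_; z≤n; s≤s⁻¹; _≤?_; _<?_)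
open import Data.Nat.Properties
  using (≤-refl; ≤-trans; <-irrefl; <⇒≤; ≰⇒>; *-mono-≤; *-monoˡ-<; m≤n⇒m<n∨m≡n; +-suc;
         +-comm; +-cancelˡ-≡; suc-injective)
open import Data.Product using (_×_; _,_; proj₁; proj₂; ∃; ∃₂; uncurry; swap; map)
open import Data.Product.Properties using (,-injective)
open import Data.Sum using (_⊎_; inj₁; inj₂; [_,_]′)
open import Data.Vec using (count; tabulate; _∷_; here; there)
open import Data.Vec.Functional using (updateAt)
open import Data.Vec.Functional.Properties using (updateAt-updates; updateAt-minimal)
open import Function using (_∘_; id; const)
open import Function.Bundles using (_⇔_; mk⇔)
open import Function.Definitions using (Injective; StrictlySurjective)
open import Level using (0ℓ)
open import Relation.Binary.PropositionalEquality
  using (_≡_; _≢_; refl; sym; trans; cong; cong₂; module ≡-Reasoning)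
open import Relation.Nullary using (¬_; Dec; yes; no; does; contradiction)
open import Relation.Nullary.Decidable
  using (_×-dec_; _⊎-dec_; ¬?; dec-true; dec-false)
open import Relation.Unary using (Pred; Decidable)

-- Unordered pairs

≐-sym : ∀ {A : Set} {e f : A × A} → e ≐ f → f ≐ e
≐-sym (inj₁ refl) = inj₁ refl
≐-sym (inj₂ refl) = inj₂ refl

≐-trans : ∀ {A : Set} {e f g : A × A} → e ≐ f → f ≐ g → e ≐ g
≐-trans (inj₁ refl) f≐g         = f≐g
≐-trans (inj₂ refl) (inj₁ refl) = inj₂ refl
≐-trans (inj₂ refl) (inj₂ refl) = inj₁ refl

≐-map : ∀ {A B : Set} (h : A → B) {e f} → e ≐ f → map h h e ≐ map h h f
≐-map h (inj₁ refl) = inj₁ refl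
≐-map h (inj₂ refl) = inj₂ refl

≐-map⁻ : ∀ {A B : Set} {h : A → B} → Injective _≡_ _≡_ h →
         ∀ {e f} → map h h e ≐ map h h f → e ≐ f
≐-map⁻ inj (inj₁ eq) with ,-injective eq
... | p , q = inj₁ (cong₂ _,_ (inj p) (inj q))
≐-map⁻ inj (inj₂ eq) with ,-injective eq
... | p , q = inj₂ (cong₂ _,_ (inj p) (inj q))

≐-distinct : ∀ {A : Set} {u w p q : A} → (u , w) ≐ (p , q) → p ≢ q → u ≢ w
≐-distinct (inj₁ refl) p≢q = p≢q
≐-distinct (inj₂ refl) p≢q = p≢q ∘ sym

-- Endofunctions of a finite set

-- Punching out a missed value would inject `Fin (suc n)` into `Fin n`.
injective⇒surjective : ∀ {n} {f : Fin n → Fin n} →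
                       Injective _≡_ _≡_ f → StrictlySurjective _≡_ f
injective⇒surjective {suc n} {f} inj y with any? (λ x → f x ≟ y)
... | yes hit = hit
... | no miss = contradiction (injective⇒≤ out-injective) (<-irrefl refl)
  where
  y≢f : ∀ x → y ≢ f x
  y≢f x eq = miss (x , sym eq)
  out-injective : Injective _≡_ _≡_ (λ x → punchOut (y≢f x))
  out-injective {x} {x′} = inj ∘ punchOut-injective (y≢f x) (y≢f x′)

-- A section `s` of `f` is injective, hence surjective, so both arguments are values of `s`, and `f`
-- recovers from such a value the index it came from.
surjective⇒injective : ∀ {n} {f : Fin n → Fin n} →
                       StrictlySurjective _≡_ f → Injective _≡_ _≡_ f
surjective⇒injective {f = f} surj {x} {y} fx≡fy
  with s-surjective x | s-surjective y
  where
  s = proj₁ ∘ surj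
  f∘s : ∀ z → f (s z) ≡ z
  f∘s = proj₂ ∘ surj
  s-surjective : StrictlySurjective _≡_ s
  s-surjective = injective⇒surjective
    (λ {z} {z′} eq → trans (sym (f∘s z)) (trans (cong f eq) (f∘s z′)))
... | z , refl | z′ , refl =
  cong (proj₁ ∘ surj)
    (trans (sym (proj₂ (surj z))) (trans fx≡fy (proj₂ (surj z′))))

collision⇒unused : ∀ {n} (f : Fin n → Fin n) {x y} → x ≢ y → f x ≡ f y →
                   ∃ λ z → ∀ x → f x ≢ z
collision⇒unused f x≢y fx≡fy with any? (λ z → ¬? (any? (λ x → f x ≟ z)))
... | yes (z , miss) = z , λ x fx≡z → miss (x , fx≡z)
... | no none = contradiction (surjective⇒injective hit fx≡fy) x≢y
  where
  hit : StrictlySurjective _≡_ f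
  hit z with any? (λ x → f x ≟ z)
  ... | yes h   = h
  ... | no miss = contradiction (z , miss) none

-- Counting

module _ {A : Set} {P : Pred A 0ℓ} (P? : Decidable P) where

  count-none : ∀ {n} (f : Fin n → A) → (∀ i → ¬ P (f i)) → count P? (tabulate f) ≡ 0
  count-none {zero}  f none = refl
  count-none {suc n} f none with P? (f zero)
  ... | yes p = contradiction p (none zero)
  ... | no _  = count-none (f ∘ suc) (none ∘ suc)

  count≡0⇒none : ∀ {n} (f : Fin n → A) → count P? (tabulate f) ≡ 0 → ∀ i → ¬ P (f i)
  count≡0⇒none {suc n} f eq i p with P? (f zero)
  count≡0⇒none {suc n} f () i       p | yes _
  count≡0⇒none {suc n} f eq zero    p | no ¬p = ¬p p
  count≡0⇒none {suc n} f eq (suc i) p | no _  = count≡0⇒none (f ∘ suc) eq i p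

  count≡suc⇒some : ∀ {n m} (f : Fin n → A) → count P? (tabulate f) ≡ suc m →
                   ∃ λ i → P (f i)
  count≡suc⇒some {suc n} f eq with P? (f zero)
  ... | yes p = zero , p
  ... | no _ with count≡suc⇒some (f ∘ suc) eq
  ...   | i , p = suc i , p

  count≡1⇒unique : ∀ {n} (f : Fin n → A) → count P? (tabulate f) ≡ 1 →
                   ∀ {i j} → P (f i) → P (f j) → i ≡ j
  count≡1⇒unique {suc n} f eq {i} {j} p q with P? (f zero)
  count≡1⇒unique {suc n} f eq {zero}  {zero}  p q | _ = refl
  count≡1⇒unique {suc n} f eq {suc i} {_}     p q | yes _ =
    contradiction p (count≡0⇒none (f ∘ suc) (suc-injective eq) i)
  count≡1⇒unique {suc n} f eq {zero}  {suc j} p q | yes _ =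
    contradiction q (count≡0⇒none (f ∘ suc) (suc-injective eq) j)
  count≡1⇒unique {suc n} f eq {zero}  {suc j} p q | no ¬p = contradiction p ¬p
  count≡1⇒unique {suc n} f eq {suc i} {zero}  p q | no ¬p = contradiction q ¬p
  count≡1⇒unique {suc n} f eq {suc i} {suc j} p q | no _  =
    cong suc (count≡1⇒unique (f ∘ suc) eq p q)

  unique⇒count≡1 : ∀ {n} (f : Fin n → A) {i} → P (f i) →
                   (∀ {j} → P (f j) → i ≡ j) → count P? (tabulate f) ≡ 1
  unique⇒count≡1 {suc n} f {i} p unique with P? (f zero)
  unique⇒count≡1 {suc n} f {suc i} p unique | yes q = contradiction (unique q) λ ()
  unique⇒count≡1 {suc n} f {zero}  p unique | yes _ =
    cong suc (count-none (f ∘ suc) (λ j q → contradiction (unique q) λ ()))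
  unique⇒count≡1 {suc n} f {zero}  p unique | no ¬p = contradiction p ¬p
  unique⇒count≡1 {suc n} f {suc i} p unique | no _  =
    unique⇒count≡1 (f ∘ suc) p (λ q → Fin-suc-injective (unique q))

-- Three separate families are allowed because the pair counts run over the blocks of two designs,
-- while crossings are counted over block indices.
count-⊎ : ∀ {A B C : Set} {P : Pred A 0ℓ} {Q : Pred B 0ℓ} {R : Pred C 0ℓ}
  (P? : Decidable P) (Q? : Decidable Q) (R? : Decidable R)
  {n} (f : Fin n → A) (g : Fin n → B) (h : Fin n → C) →
  (∀ i → P (f i) → Q (g i) ⊎ R (h i)) →
  (∀ i → Q (g i) → P (f i)) → (∀ i → R (h i) → P (f i)) →
  (∀ i → Q (g i) → ¬ R (h i)) →
  count P? (tabulate f) ≡ count Q? (tabulate g) + count R? (tabulate h)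
count-⊎ P? Q? R? {zero} f g h split fromQ fromR disjoint = refl
count-⊎ P? Q? R? {suc n} f g h split fromQ fromR disjoint
  with ih ← count-⊎ P? Q? R? (f ∘ suc) (g ∘ suc) (h ∘ suc)
              (split ∘ suc) (fromQ ∘ suc) (fromR ∘ suc) (disjoint ∘ suc)
  with P? (f zero) | Q? (g zero) | R? (h zero)
... | _     | yes q | yes r = contradiction r (disjoint zero q)
... | yes _ | yes _ | no _  = cong suc ih
... | yes _ | no _  | yes _ = trans (cong suc ih) (sym (+-suc _ _))
... | yes p | no ¬q | no ¬r = contradiction (split zero p) [ ¬q , ¬r ]′
... | no ¬p | yes q | no _  = contradiction (fromQ zero q) ¬p
... | no ¬p | no _  | yes r = contradiction (fromR zero r) ¬p
... | no _  | no _  | no _  = ih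

∣p∪⁅x⁆∣≡1+∣p∣ : ∀ {n} (p : Subset n) {x} → x ∉ p → ∣ p ∪ ⁅ x ⁆ ∣ ≡ suc ∣ p ∣
∣p∪⁅x⁆∣≡1+∣p∣ (inside  ∷ p) {zero}  x∉p = contradiction here x∉p
∣p∪⁅x⁆∣≡1+∣p∣ (outside ∷ p) {zero}  x∉p = cong (suc ∘ ∣_∣) (∪-identityʳ p)
∣p∪⁅x⁆∣≡1+∣p∣ (inside  ∷ p) {suc x} x∉p = cong suc (∣p∪⁅x⁆∣≡1+∣p∣ p (x∉p ∘ there))
∣p∪⁅x⁆∣≡1+∣p∣ (outside ∷ p) {suc x} x∉p = ∣p∪⁅x⁆∣≡1+∣p∣ p (x∉p ∘ there)

-- The harmonious chromatic number

-- The v(v-1) ordered pairs of distinct `c`-colours are realised by oriented edges, and `d` gives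
-- these different ordered pairs of colours. So v(v-1) is at most n², which fails for 0 < n < v.
exact⇒minimal : ∀ (G : Graph) {v} {c : Vertex G → Fin v} → IsExact G c →
  (Fin v → Vertex G) → ∀ n → HarmoniouslyColourable G n → v ≤ n
exact⇒minimal G {zero}  {c} exact vertex n _ = z≤n
exact⇒minimal G {suc m} {c} exact vertex n (d , H) with suc m ≤? n
... | yes v≤n = v≤n
... | no  v≰n = contradiction (injective⇒≤ code-injective) (too-few m n (s≤s⁻¹ (≰⇒> v≰n)) d₀)
  where
  open IsHarmonious H
  -- The case v = 1, n = 0 satisfies the inequality, so it is excluded by exhibiting a colour.
  d₀ : Fin n
  d₀ = d (vertex zero)

  too-few : ∀ m n → n ≤ m → Fin n → ¬ (suc m * m ≤ n * n)
  too-few zero    (suc n) () i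
  too-few (suc m) n n≤m _ le = <-irrefl refl
    (≤-trans (*-monoˡ-< (suc m) (≤-refl {suc (suc m)})) (≤-trans le (*-mono-≤ n≤m n≤m)))

  oriented : ∀ p q → p ≢ q → ∃ λ e → Edge G e × map c c e ≡ (p , q)
  oriented p q p≢q with exact p q p≢q
  ... | e , (edge , inj₁ eq)   , _ = e , edge , eq
  ... | e , (edge , inj₂ refl) , _ = swap e , Graph.sym G edge , refl

  -- `punchIn i` enumerates the colours other than `i`, so this product indexes the ordered pairs of
  -- distinct colours.
  edgeOf : (ij : Fin (suc m) × Fin m) →
    ∃ λ e → Edge G e × map c c e ≡ (proj₁ ij , punchIn (proj₁ ij) (proj₂ ij))
  edgeOf (i , j) = oriented i (punchIn i j) (punchInᵢ≢i i j ∘ sym)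

  edgeOf-injective : ∀ ij ij′ →
    map d d (proj₁ (edgeOf ij)) ≡ map d d (proj₁ (edgeOf ij′)) → ij ≡ ij′
  edgeOf-injective ij@(i , j) ij′@(i′ , j′) eq
    with (e , edge , ce) ← edgeOf ij | (e′ , edge′ , ce′) ← edgeOf ij′
    with harmonious edge edge′ (inj₁ eq)
  -- Opposite orientations of one edge with equal ordered colour pairs would give both ends the same
  -- colour.
  ... | inj₂ refl = contradiction (cong proj₂ eq) (proper edge′)
  ... | inj₁ refl with refl ← cong proj₁ (trans (sym ce) ce′) =
    cong (i ,_) (punchIn-injective i j j′ (cong proj₂ (trans (sym ce) ce′)))

  code : Fin (suc m * m) → Fin (n * n)
  code k = uncurry combine (map d d (proj₁ (edgeOf (remQuot m k))))

  code-injective : Injective _≡_ _≡_ code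
  code-injective {k} {k′} eq =
    trans (sym (combine-remQuot {suc m} m k))
      (trans (cong (uncurry combine) same) (combine-remQuot {suc m} m k′))
    where
    same : remQuot {suc m} m k ≡ remQuot m k′
    same = edgeOf-injective _ _ (uncurry (cong₂ _,_) (combine-injective _ _ _ _ eq))

-- Exact colourings of the Levi graph

-- A Levi edge is stored once, as an incidence of a point with a block index, so that `≐` is left
-- only on colours. `injective` is harmoniousness; `surjective` is the existence half of exactness.
record IsExactLabelling {v} (D : Design v) {C : Set}
                        (f : Fin v → C) (g : Fin (b D) → C) : Set where
  field
    proper     : ∀ {x i} → x ∈ block D i → f x ≢ g i
    injective  : ∀ {x y i j} → x ∈ block D i → y ∈ block D j →
                 (f x , g i) ≐ (f y , g j) → (x , i) ≡ (y , j)
    surjective : ∀ p q → p ≢ q → ∃₂ λ x i → x ∈ block D i × (f x , g i) ≐ (p , q)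

module _ {v} {D : Design v} {C : Set} where

  fromColouring : {c : Vertex (Levi D) → C} →
    IsHarmonious (Levi D) c → IsExact (Levi D) c →
    IsExactLabelling D (c ∘ inj₁) (c ∘ inj₂)
  fromColouring {c} H exact = record
    { proper     = λ {x} {i} → IsHarmonious.proper H {inj₁ x} {inj₂ i}
    ; injective  = injective
    ; surjective = surjective
    }
    where
    injective : ∀ {x y i j} → x ∈ block D i → y ∈ block D j →
                (c (inj₁ x) , c (inj₂ i)) ≐ (c (inj₁ y) , c (inj₂ j)) → (x , i) ≡ (y , j)
    injective {x} {y} {i} {j} x∈ y∈ eq
      with IsHarmonious.harmonious H {inj₁ x , inj₂ i} {inj₁ y , inj₂ j} x∈ y∈ eq
    ... | inj₁ refl = refl
    ... | inj₂ ()

    surjective : ∀ p q → p ≢ q →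
      ∃₂ λ x i → x ∈ block D i × (c (inj₁ x) , c (inj₂ i)) ≐ (p , q)
    surjective p q p≢q with exact p q p≢q
    ... | (inj₁ x , inj₂ i) , (x∈ , eq) , _ = x , i , x∈ , eq
    ... | (inj₂ i , inj₁ x) , (x∈ , eq) , _ = x , i , x∈ , ≐-trans (inj₂ refl) eq
    ... | (inj₁ _ , inj₁ _) , (() , _) , _
    ... | (inj₂ _ , inj₂ _) , (() , _) , _

  edge⇒incidence : ∀ e → Edge (Levi D) e →
    ∃₂ λ x i → x ∈ block D i × e ≐ (inj₁ x , inj₂ i)
  edge⇒incidence (inj₁ x , inj₂ i) x∈ = x , i , x∈ , inj₁ refl
  edge⇒incidence (inj₂ i , inj₁ x) x∈ = x , i , x∈ , inj₂ refl

  toColouring : {f : Fin v → C} {g : Fin (b D) → C} → IsExactLabelling D f g →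
    IsHarmonious (Levi D) [ f , g ]′ × IsExact (Levi D) [ f , g ]′
  toColouring {f} {g} L =
    record { proper     = λ {u} {w} → proper {u} {w}
           ; harmonious = λ {e} {e′} → harmonious {e} {e′} } , exact
    where
    module L = IsExactLabelling L
    c : Vertex (Levi D) → C
    c = [ f , g ]′

    proper : ∀ {u w} → LeviAdj D u w → c u ≢ c w
    proper {inj₁ x} {inj₂ i} x∈ = L.proper x∈
    proper {inj₂ i} {inj₁ x} x∈ = L.proper x∈ ∘ sym

    harmonious : ∀ {e e′} → Edge (Levi D) e → Edge (Levi D) e′ →
                 map c c e ≐ map c c e′ → e ≐ e′
    harmonious {e} {e′} edge edge′ eq
      with edge⇒incidence e edge | edge⇒incidence e′ edge′
    ... | x , i , x∈ , e≐ | y , j , y∈ , e′≐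
      with refl ← L.injective x∈ y∈
             (≐-trans (≐-sym (≐-map c e≐)) (≐-trans eq (≐-map c e′≐))) =
      ≐-trans e≐ (≐-sym e′≐)

    exact : IsExact (Levi D) c
    exact p q p≢q with L.surjective p q p≢q
    ... | x , i , x∈ , eq =
      (inj₁ x , inj₂ i) , (x∈ , eq) ,
      λ {e} (edge , eq′) → harmonious {inj₁ x , inj₂ i} {e} x∈ edge (≐-trans eq (≐-sym eq′))

-- An injective `f` permutes the colours, and renaming all colours by its inverse makes every point
-- its own colour.
relabel : ∀ {v} {D : Design v} {f : Fin v → Fin v} {g : Fin (b D) → Fin v} →
  Injective _≡_ _≡_ f → IsExactLabelling D f g →
  ∃ λ φ → IsExactLabelling D id φ
relabel {D = D} {f} {g} f-inj L = φ , record
  { proper     = λ {x} {i} x∈ x≡φi → L.proper x∈ (trans (cong f x≡φi) (f∘φ i))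
  ; injective  = λ {x} {y} {i} {j} x∈ y∈ eq → L.injective x∈ y∈
      (≐-trans (toL x i) (≐-trans (≐-map f eq) (≐-sym (toL y j))))
  ; surjective = surjective
  }
  where
  module L = IsExactLabelling L
  preimage = injective⇒surjective f-inj
  φ = proj₁ ∘ preimage ∘ g
  f∘φ : ∀ i → f (φ i) ≡ g i
  f∘φ i = proj₂ (preimage (g i))
  toL : ∀ x i → (f x , g i) ≐ (f x , f (φ i))
  toL x i = inj₁ (cong (f x ,_) (sym (f∘φ i)))
  surjective : ∀ p q → p ≢ q → ∃₂ λ x i → x ∈ block D i × (x , φ i) ≐ (p , q)
  surjective p q p≢q with L.surjective (f p) (f q) (p≢q ∘ f-inj)
  ... | x , i , x∈ , eq = x , i , x∈ , ≐-map⁻ f-inj (≐-trans (≐-sym (toL x i)) eq)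

-- Perfect nestings as labellings

module _ {v} (D : Design v) (φ : Fin (b D) → Fin v) where

  -- For x ≠ y and φ(A) outside A, these are the blocks that gain the pair {x , y} from φ(A).
  -- Equally, they carry a Levi edge coloured {x , y} when points colour themselves.
  Crosses : Fin v → Fin v → Fin (b D) → Set
  Crosses x y i = (x ∈ block D i × φ i ≡ y) ⊎ (y ∈ block D i × φ i ≡ x)

  crosses? : ∀ x y → Decidable (Crosses x y)
  crosses? x y i =
    ((x ∈? block D i) ×-dec (φ i ≟ y)) ⊎-dec ((y ∈? block D i) ×-dec (φ i ≟ x))

  crossings : Fin v → Fin v → ℕ
  crossings x y = count (crosses? x y) (tabulate id)

  Crosses⇒incidence : ∀ {x y i} → Crosses x y i →
    ∃ λ u → u ∈ block D i × (u , φ i) ≐ (x , y)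
  Crosses⇒incidence {x} (inj₁ (x∈ , refl)) = x , x∈ , inj₁ refl
  Crosses⇒incidence {y = y} (inj₂ (y∈ , refl)) = y , y∈ , inj₂ refl

  incidence⇒Crosses : ∀ {x y u i} → u ∈ block D i → (u , φ i) ≐ (x , y) → Crosses x y i
  incidence⇒Crosses u∈ (inj₁ refl) = inj₁ (u∈ , refl)
  incidence⇒Crosses u∈ (inj₂ refl) = inj₂ (u∈ , refl)

  -- A pair in A ∪ {φ(A)} lies in A or has φ(A) as one of its points. The cases exclude each other
  -- because φ(A) is outside A, and x ≠ y rules out both points being φ(A).
  pairCount-augment : (∀ i → φ i ∉ block D i) → ∀ x y → x ≢ y →
    pairCount (augment D φ) x y ≡ pairCount D x y + crossings x y
  pairCount-augment φ∉ x y x≢y = count-⊎ _ _ (crosses? x y) _ _ id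
    split
    (λ i (x∈ , y∈) → x∈p∪q⁺ (inj₁ x∈) , x∈p∪q⁺ (inj₁ y∈))
    (λ { i (inj₁ (x∈ , refl)) → x∈p∪q⁺ (inj₁ x∈) , x∈p∪q⁺ (inj₂ (x∈⁅x⁆ _))
       ; i (inj₂ (y∈ , refl)) → x∈p∪q⁺ (inj₂ (x∈⁅x⁆ _)) , x∈p∪q⁺ (inj₁ y∈) })
    (λ { i (x∈ , y∈) (inj₁ (_ , refl)) → φ∉ i y∈
       ; i (x∈ , y∈) (inj₂ (_ , refl)) → φ∉ i x∈ })
    where
    split : ∀ i → x ∈ block D i ∪ ⁅ φ i ⁆ × y ∈ block D i ∪ ⁅ φ i ⁆ →
            (x ∈ block D i × y ∈ block D i) ⊎ Crosses x y i
    split i (x∈ , y∈) with x∈p∪q⁻ (block D i) ⁅ φ i ⁆ x∈ | x∈p∪q⁻ (block D i) ⁅ φ i ⁆ y∈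
    ... | inj₁ x∈A | inj₁ y∈A = inj₁ (x∈A , y∈A)
    ... | inj₁ x∈A | inj₂ y≡φ = inj₂ (inj₁ (x∈A , sym (x∈⁅y⁆⇒x≡y _ y≡φ)))
    ... | inj₂ x≡φ | inj₁ y∈A = inj₂ (inj₂ (y∈A , sym (x∈⁅y⁆⇒x≡y _ x≡φ)))
    ... | inj₂ x≡φ | inj₂ y≡φ =
      contradiction (trans (x∈⁅y⁆⇒x≡y _ x≡φ) (sym (x∈⁅y⁆⇒x≡y _ y≡φ))) x≢y

  module _ {k ƛ} (bibd : IsBIBD v k ƛ D) where
    open IsBIBD bibd

    -- Each pair count rises from λ to λ + 1, so every pair is crossed exactly once: existence gives
    -- `surjective`, uniqueness gives `injective`.
    nesting⇒labelling : IsPerfectNesting v k ƛ D φ → IsExactLabelling D id φ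
    nesting⇒labelling N = record
      { proper = proper ; injective = injective ; surjective = surjective }
      where
      open IsPerfectNesting N renaming (outside to φ∉)

      crossings≡1 : ∀ x y → x ≢ y → crossings x y ≡ 1
      crossings≡1 x y x≢y = +-cancelˡ-≡ ƛ _ _ (begin
        ƛ + crossings x y               ≡⟨ cong (_+ _) (sym (balanced x y x≢y)) ⟩
        pairCount D x y + crossings x y ≡⟨ sym (pairCount-augment φ∉ x y x≢y) ⟩
        pairCount (augment D φ) x y     ≡⟨ IsBIBD.balanced nested x y x≢y ⟩
        suc ƛ                           ≡⟨ +-comm 1 ƛ ⟩
        ƛ + 1                           ∎)
        where open ≡-Reasoning

      proper : ∀ {x i} → x ∈ block D i → x ≢ φ i
      proper {i = i} x∈ refl = φ∉ i x∈

      injective : ∀ {x y i j} → x ∈ block D i → y ∈ block D j →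
                  (x , φ i) ≐ (y , φ j) → (x , i) ≡ (y , j)
      injective {x} {y} {i} {j} x∈ y∈ eq
        -- Both blocks cross the pair {y , φ j}, hence they have the same index.
        with refl ← count≡1⇒unique (crosses? y (φ j)) id (crossings≡1 y (φ j) (proper y∈))
                      (incidence⇒Crosses x∈ eq) (incidence⇒Crosses y∈ (inj₁ refl))
        with eq
      ... | inj₁ refl = refl
      ... | inj₂ eq′  = contradiction (cong proj₁ eq′) (proper x∈)

      surjective : ∀ p q → p ≢ q → ∃₂ λ x i → x ∈ block D i × (x , φ i) ≐ (p , q)
      surjective p q p≢q with count≡suc⇒some (crosses? p q) id (crossings≡1 p q p≢q)
      ... | i , cross with Crosses⇒incidence cross
      ...   | x , x∈ , eq = x , i , x∈ , eq

    labelling⇒nesting : IsExactLabelling D id φ → IsPerfectNesting v k ƛ D φ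
    labelling⇒nesting L = record
      { outside = φ∉
      ; nested  = record
        { blockSize = λ i → trans (∣p∪⁅x⁆∣≡1+∣p∣ (block D i) (φ∉ i)) (cong suc (blockSize i))
        ; balanced  = λ x y x≢y → begin
            pairCount (augment D φ) x y     ≡⟨ pairCount-augment φ∉ x y x≢y ⟩
            pairCount D x y + crossings x y ≡⟨ cong₂ _+_ (balanced x y x≢y) (crossings≡1 x y x≢y) ⟩
            ƛ + 1                           ≡⟨ +-comm ƛ 1 ⟩
            suc ƛ                           ∎
        }
      }
      where
      open ≡-Reasoning
      module L = IsExactLabelling L
      φ∉ : ∀ i → φ i ∉ block D i
      φ∉ i φi∈ = L.proper φi∈ refl

      crossings≡1 : ∀ x y → x ≢ y → crossings x y ≡ 1
      crossings≡1 x y x≢y with L.surjective x y x≢y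
      ... | u , i , u∈ , eq =
        unique⇒count≡1 (crosses? x y) id (incidence⇒Crosses u∈ eq) unique
        where
        unique : ∀ {j} → Crosses x y j → i ≡ j
        unique cross with Crosses⇒incidence cross
        ... | w , w∈ , eq′ = cong proj₂ (L.injective u∈ w∈ (≐-trans eq (≐-sym eq′)))

-- Separating the colours of the points

transpose-comm : ∀ {n} (i j k : Fin n) → transpose i j k ≡ transpose j i k
transpose-comm i j k with k ≟ i | k ≟ j
... | yes refl | yes refl = refl
... | yes k≡i  | no _     rewrite dec-true (k ≟ i) k≡i = refl
... | no _     | yes k≡j  rewrite dec-true (k ≟ j) k≡j = refl
... | no k≢i   | no k≢j   rewrite dec-false (k ≟ i) k≢i | dec-false (k ≟ j) k≢j = refl

transpose-involutive : ∀ {n} (i j k : Fin n) → transpose i j (transpose i j k) ≡ k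
transpose-involutive i j k =
  trans (cong (transpose i j) (transpose-comm i j k)) (transpose-inverse i j)

transpose-matchˡ : ∀ {n} (i j : Fin n) → transpose i j i ≡ j
transpose-matchˡ i j rewrite dec-true (i ≟ i) refl = refl

transpose-matchʳ : ∀ {n} (i j : Fin n) → transpose i j j ≡ i
transpose-matchʳ i j = trans (transpose-comm i j j) (transpose-matchˡ j i)

transpose-mismatch : ∀ {n} {i j k : Fin n} → k ≢ i → k ≢ j → transpose i j k ≡ k
transpose-mismatch {i = i} {j} {k} k≢i k≢j
  rewrite dec-false (k ≟ i) k≢i | dec-false (k ≟ j) k≢j = refl

-- Exchanges the unordered pairs {a , w} and {z , w} for every w in S.
module Switch {n} (a z : Fin n) (S : Fin n → Bool)
              (a∉S : S a ≡ false) (z∉S : S z ≡ false) where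

  flipIf : Fin n → Fin n → Fin n
  flipIf w u = if S w then transpose a z u else u

  switch : Fin n × Fin n → Fin n × Fin n
  switch (u , w) = flipIf w u , flipIf u w

  -- Neither `a` nor `z` is in `S`, so flips do not affect membership in `S`. A second `switch`
  -- therefore repeats the decisions of the first and undoes them.
  S-transpose : ∀ u → S (transpose a z u) ≡ S u
  S-transpose u with u ≟ a
  ... | yes refl = trans z∉S (sym a∉S)
  ... | no _ with u ≟ z
  ...   | yes refl = trans a∉S (sym z∉S)
  ...   | no _     = refl

  S-flipIf : ∀ w u → S (flipIf w u) ≡ S u
  S-flipIf w u with S w
  ... | true  = S-transpose u
  ... | false = refl

  flipIf-cancel : ∀ w w′ u → S w ≡ S w′ → flipIf w (flipIf w′ u) ≡ u
  flipIf-cancel w w′ u eq rewrite eq with S w′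
  ... | true  = transpose-involutive a z u
  ... | false = refl

  flipIf-false : ∀ {w} u → S w ≡ false → flipIf w u ≡ u
  flipIf-false u eq rewrite eq = refl

  flipIf-true : ∀ {w} u → S w ≡ true → flipIf w u ≡ transpose a z u
  flipIf-true u eq rewrite eq = refl

  flipIf-fixed : ∀ w {u} → (S w ≡ true → u ≢ a) → u ≢ z → flipIf w u ≡ u
  flipIf-fixed w u≢a u≢z with S w
  ... | true  = transpose-mismatch (u≢a refl) u≢z
  ... | false = refl

  switch-involutive : ∀ e → switch (switch e) ≡ e
  switch-involutive (u , w) = cong₂ _,_
    (flipIf-cancel (flipIf u w) w u (S-flipIf u w))
    (flipIf-cancel (flipIf w u) u w (S-flipIf w u))

  switch-≐ : ∀ {e f} → e ≐ f → switch e ≐ switch f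
  switch-≐ (inj₁ refl) = inj₁ refl
  switch-≐ (inj₂ refl) = inj₂ refl

  switch-injective : ∀ {e f} → switch e ≐ switch f → e ≐ f
  switch-injective {e} {f} eq =
    ≐-trans (inj₁ (sym (switch-involutive e)))
      (≐-trans (switch-≐ eq) (inj₁ (switch-involutive f)))

  -- Switching back treats both coordinates alike, so equal coordinates would come back equal.
  switch-distinct : ∀ {u w} → u ≢ w → proj₁ (switch (u , w)) ≢ proj₂ (switch (u , w))
  switch-distinct {u} {w} u≢w eq = u≢w (begin
    u                                ≡⟨ sym (flipIf-cancel (flipIf u w) w u (S-flipIf u w)) ⟩
    flipIf (flipIf u w) (flipIf w u) ≡⟨ cong₂ flipIf (sym eq) eq ⟩
    flipIf (flipIf w u) (flipIf u w) ≡⟨ flipIf-cancel (flipIf w u) u w (S-flipIf w u) ⟩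
    w                                ∎)
    where open ≡-Reasoning

does⇒ : ∀ {P : Set} (P? : Dec P) → does P? ≡ true → P
does⇒ (yes p) _ = p

module _ {v} (D : Design v)
         (single : ∀ {x y i} → x ∈ block D i → y ∈ block D i → x ≡ y) where

  module Recolour {f : Fin v → Fin v} {g : Fin (b D) → Fin v} (L : IsExactLabelling D f g)
                  (p z : Fin v) (unused : ∀ x → f x ≢ z) where
    module L = IsExactLabelling L

    a : Fin v
    a = f p

    -- With its new colour z, p turns its edges {a , w} into {z , w}, so the former
    -- edges {z , w} have to become {a , w}.  As an unordered pair {a , z} can stay.
    met? : Decidable (λ w → w ≢ z × ∃ λ i → p ∈ block D i × g i ≡ w)
    met? w = ¬? (w ≟ z) ×-dec any? (λ i → (p ∈? block D i) ×-dec (g i ≟ w))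

    S : Fin v → Bool
    S w = does (met? w)

    a∉S : S a ≡ false
    a∉S = dec-false (met? a) (λ (_ , i , p∈ , gi≡a) → L.proper p∈ (sym gi≡a))

    z∉S : S z ≡ false
    z∉S = dec-false (met? z) (λ (z≢z , _) → z≢z refl)

    open Switch a z S a∉S z∉S

    -- The blocks on whose colour `a` and `z` are exchanged. At `p` this matters only for a block
    -- coloured `z`; elsewhere it carries out the switch on edges whose point has its colour in `S`.
    Touched : Fin (b D) → Set
    Touched i = ∃ λ x → x ∈ block D i × (x ≡ p ⊎ S (f x) ≡ true)

    touched? : Decidable Touched
    touched? i = any? λ x → (x ∈? block D i) ×-dec ((x ≟ p) ⊎-dec (S (f x) ≟ᵇ true))

    f′ : Fin v → Fin v
    f′ = updateAt f p (const z)

    g′ : Fin (b D) → Fin v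
    g′ i = if does (touched? i) then transpose a z (g i) else g i

    g′-touched : ∀ {i} → Touched i → g′ i ≡ transpose a z (g i)
    g′-touched {i} t rewrite dec-true (touched? i) t = refl

    g′-untouched : ∀ {i} → ¬ Touched i → g′ i ≡ g i
    g′-untouched {i} t rewrite dec-false (touched? i) t = refl

    -- By `single`, `x` is the only point of its block, so it alone decides whether the block is
    -- touched.
    g′-other : ∀ {x i} → x ∈ block D i → x ≢ p → g′ i ≡ flipIf (f x) (g i)
    g′-other {x} {i} x∈ x≢p with S (f x) in eq
    ... | true  = g′-touched (x , x∈ , inj₂ eq)
    ... | false = g′-untouched λ where
      (y , y∈ , inj₁ refl) → x≢p (single x∈ y∈)
      (y , y∈ , inj₂ Sfy)  → contradiction
        (trans (sym Sfy) (trans (cong (S ∘ f) (single y∈ x∈)) eq)) λ ()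

    -- The switch could move the colour of `x` only if it is `a` and the block colour w is in `S`.
    -- But {a , w} already occurs on an edge at `p`, which forces `x` to be `p`.
    f-other : ∀ {x i} → x ∈ block D i → x ≢ p → flipIf (g i) (f x) ≡ f x
    f-other {x} {i} x∈ x≢p = flipIf-fixed (g i) fx≢a (unused x)
      where
      fx≢a : S (g i) ≡ true → f x ≢ a
      fx≢a Sgi fx≡a with does⇒ (met? (g i)) Sgi
      ... | _ , j , p∈ , gj≡gi =
        x≢p (cong proj₁ (L.injective x∈ p∈ (inj₁ (cong₂ _,_ fx≡a (sym gj≡gi)))))

    -- The new colouring is the old one followed by `switch`. As `switch` permutes the unordered
    -- pairs of distinct colours, exactness carries over.
    recoloured : ∀ {x i} → x ∈ block D i → (f′ x , g′ i) ≐ switch (f x , g i)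
    recoloured {x} {i} x∈ = cases (x ≟ p) (g i ≟ z)
      where
      open ≡-Reasoning
      cases : Dec (x ≡ p) → Dec (g i ≡ z) → (f′ x , g′ i) ≐ switch (f x , g i)
      cases (no x≢p) _ = inj₁ (cong₂ _,_
        (trans (updateAt-minimal x p f x≢p) (sym (f-other x∈ x≢p)))
        (g′-other x∈ x≢p))
      -- The edge coloured {a , z} at `p` keeps its pair with the ends exchanged, hence `inj₂`.
      cases (yes refl) (yes gi≡z) = inj₂ (cong₂ _,_
        (trans (updateAt-updates p f) (sym (trans (flipIf-false (g i) a∉S) gi≡z)))
        (begin
          g′ i                ≡⟨ g′-touched (p , x∈ , inj₁ refl) ⟩
          transpose a z (g i) ≡⟨ cong (transpose a z) gi≡z ⟩
          transpose a z z     ≡⟨ transpose-matchʳ a z ⟩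
          a                   ≡⟨ sym (flipIf-false a (trans (cong S gi≡z) z∉S)) ⟩
          flipIf (g i) a      ∎))
      -- This very edge witnesses that `g i` is in `S`.
      cases (yes refl) (no gi≢z) = inj₁ (cong₂ _,_
        (begin
          f′ p            ≡⟨ updateAt-updates p f ⟩
          z               ≡⟨ sym (transpose-matchˡ a z) ⟩
          transpose a z a ≡⟨ sym (flipIf-true a (dec-true (met? (g i)) (gi≢z , i , x∈ , refl))) ⟩
          flipIf (g i) a  ∎)
        (begin
          g′ i                ≡⟨ g′-touched (p , x∈ , inj₁ refl) ⟩
          transpose a z (g i) ≡⟨ transpose-mismatch (L.proper x∈ ∘ sym) gi≢z ⟩
          g i                 ≡⟨ sym (flipIf-false (g i) a∉S) ⟩
          flipIf a (g i)      ∎))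

    labelling : IsExactLabelling D f′ g′
    labelling = record
      { proper     = λ x∈ → ≐-distinct (recoloured x∈) (switch-distinct (L.proper x∈))
      ; injective  = λ x∈ y∈ eq → L.injective x∈ y∈ (switch-injective
          (≐-trans (≐-sym (recoloured x∈)) (≐-trans eq (recoloured y∈))))
      ; surjective = surjective
      }
      where
      surjective : ∀ u w → u ≢ w → ∃₂ λ x i → x ∈ block D i × (f′ x , g′ i) ≐ (u , w)
      surjective u w u≢w
        with L.surjective (flipIf w u) (flipIf u w) (switch-distinct u≢w)
      ... | x , i , x∈ , eq = x , i , x∈ ,
        ≐-trans (recoloured x∈) (≐-trans (switch-≐ eq) (inj₁ (switch-involutive (u , w))))

  InjectiveBelow : ℕ → (Fin v → Fin v) → Set
  InjectiveBelow m f = ∀ {x y} → toℕ x < m → toℕ y < m → f x ≡ f y → x ≡ y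

  extend : ∀ {m} {f : Fin v → Fin v} p → toℕ p ≡ m → InjectiveBelow m f →
    (∀ {x} → toℕ x < m → f x ≢ f p) → InjectiveBelow (suc m) f
  extend {m} {f} p refl inj fresh {x} {y} x<m y<m eq
    with m≤n⇒m<n∨m≡n (s≤s⁻¹ x<m) | m≤n⇒m<n∨m≡n (s≤s⁻¹ y<m)
  ... | inj₁ x<p | inj₁ y<p = inj x<p y<p eq
  ... | inj₂ x≡p | inj₂ y≡p = toℕ-injective (trans x≡p (sym y≡p))
  ... | inj₁ x<p | inj₂ y≡p =
    contradiction (trans eq (cong f (toℕ-injective y≡p))) (fresh x<p)
  ... | inj₂ x≡p | inj₁ y<p =
    contradiction (trans (sym eq) (cong f (toℕ-injective x≡p))) (fresh y<p)

  -- Induction on `m`: if the point numbered `m` shares its colour with an earlier point, it alone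
  -- among the points is recoloured, with a colour that no point has.
  separate : ∀ {f : Fin v → Fin v} {g} → IsExactLabelling D f g → ∀ m → m ≤ v →
    ∃₂ λ f′ g′ → IsExactLabelling D f′ g′ × InjectiveBelow m f′
  separate L zero    _   = _ , _ , L , λ ()
  separate L (suc m) m<v with separate L m (<⇒≤ m<v)
  ... | f , g , M , inj with any? (λ q → (toℕ q <? m) ×-dec (f q ≟ f (fromℕ< m<v)))
  ... | no none = f , g , M ,
    extend (fromℕ< m<v) (toℕ-fromℕ< m<v) inj (λ x<m eq → none (_ , x<m , eq))
  ... | yes (q , q<m , fq≡fp) =
    f′ , g′ , labelling , extend p (toℕ-fromℕ< m<v) inj′ fresh
    where
    p = fromℕ< m<v
    below≢p : ∀ {x} → toℕ x < m → x ≢ p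
    below≢p x<m refl = <-irrefl (toℕ-fromℕ< m<v) x<m
    -- There are as many points as colours, so the collision of `q` with `p` leaves a colour without
    -- points.
    free = collision⇒unused f (below≢p q<m) fq≡fp
    open Recolour M p (proj₁ free) (proj₂ free)
    f′-below : ∀ {x} → toℕ x < m → f′ x ≡ f x
    f′-below x<m = updateAt-minimal _ p f (below≢p x<m)
    inj′ : InjectiveBelow m f′
    inj′ x<m y<m eq = inj x<m y<m (trans (sym (f′-below x<m)) (trans eq (f′-below y<m)))
    fresh : ∀ {x} → toℕ x < m → f′ x ≢ f′ p
    fresh {x} x<m eq =
      proj₂ free x (trans (sym (f′-below x<m)) (trans eq (updateAt-updates p f)))

injectiveLabelling : ∀ {v k ƛ} {D : Design v} → IsBIBD v k ƛ D →
  {f : Fin v → Fin v} {g : Fin (b D) → Fin v} → IsExactLabelling D f g →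
  ∃₂ λ (f′ : Fin v → Fin v) g′ → IsExactLabelling D f′ g′ × Injective _≡_ _≡_ f′
injectiveLabelling {v} {ƛ = zero} {D} bibd L
  with separate D single L v ≤-refl
  where
  single : ∀ {x y i} → x ∈ block D i → y ∈ block D i → x ≡ y
  single {x} {y} {i} x∈ y∈ with x ≟ y
  ... | yes x≡y = x≡y
  ... | no  x≢y = contradiction (x∈ , y∈)
    (count≡0⇒none _ (block D) (IsBIBD.balanced bibd x y x≢y) i)
... | f′ , g′ , L′ , inj = f′ , g′ , L′ , inj (toℕ<n _) (toℕ<n _)
injectiveLabelling {ƛ = suc ƛ} {D} bibd {f} {g} L = f , g , L , inj
  where
  inj : Injective _≡_ _≡_ f
  inj {x} {y} fx≡fy with x ≟ y
  ... | yes x≡y = x≡y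
  ... | no  x≢y with count≡suc⇒some _ (block D) (IsBIBD.balanced bibd x y x≢y)
  -- The edges from `x` and `y` to a common block would have the same colour pair.
  ...   | i , x∈ , y∈ =
    cong proj₁ (IsExactLabelling.injective L x∈ y∈ (inj₁ (cong (_, g i) fx≡fy)))

theorem5p2 : ∀ (v k ƛ : ℕ) (D : Design v) → IsBIBD v k ƛ D →
    HasPerfectNesting v k ƛ D ⇔ (IsBanff v D × HasExactColouring v D)
theorem5p2 v k ƛ D bibd = mk⇔ to from
  where
  to : HasPerfectNesting v k ƛ D → IsBanff v D × HasExactColouring v D
  to (φ , N) with toColouring (nesting⇒labelling D φ bibd N)
  ... | H , exact =
    -- Colours and points are both indexed by `Fin v`, so `inj₁` supplies a vertex whenever there is
    -- a colour.
    record { colourable = _ , H ; minimal = exact⇒minimal (Levi D) exact inj₁ } ,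
    _ , H , exact

  from : IsBanff v D × HasExactColouring v D → HasPerfectNesting v k ƛ D
  from (_ , c , H , exact) with injectiveLabelling bibd (fromColouring H exact)
  ... | f , g , L , inj with relabel inj L
  ...   | φ , M = φ , labelling⇒nesting D φ bibd M
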